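{- Let $n\ge 2$ be an integer and let $(X,d)$ be a metric space with $|X|=n$. Let $\rho$ be the ratio between the largest distance and the smallest nonzero distance in $(X,d)$. Then there are at least $0.25\,(n/\rho)^{2/3}$ distinct lines in $(X,d)$.
   Context: For points $a,b,c$ of a metric space $(X,d)$, write $[abc]$ if $a,b,c$ are three distinct points and $d(a,b)+d(b,c)=d(a,c)$. For any two distinct points $u,v\in X$, the line $\overline{uv}$ is the set $\{p:[puv]\}\cup\{u\}\cup\{p:[upv]\}\cup\{v\}\cup\{p:[uvp]\}$. The lines of $(X,d)$ are the sets $\overline{uv}$ with $u,v$ ranging over pairs of distinct points; distinct lines are counted as distinct subsets of $X$. -}

module Defs where

open import Data.Fin.Base using (Fin)
open import Data.Integer.Base using (+_)
open import Data.Nat.Base as ℕ using (ℕ; zero; suc)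
import Data.Nat.Properties as ℕ
open import Data.Product.Base using (∃; ∃₂; _×_; _,_; proj₁; swap)
open import Data.Rational.Base as ℚ using (ℚ; 0ℚ; 1ℚ; ½; ∣_∣)
import Data.Rational.Properties as ℚ
open import Data.Rational.Solver using (module +-*-Solver)
open import Data.Sum.Base using (_⊎_)
open import Function.Bundles using (Bijection)
import Function.Metric.Structures as Metric
open import Level using (Level)
open import Relation.Binary.Bundles using (Setoid)
import Relation.Binary.Construct.On as On
open import Relation.Binary.Core using (Rel)
open import Relation.Binary.PropositionalEquality
  using (_≡_; _≢_; refl; sym; cong; cong₂; subst; setoid; module ≡-Reasoning)
open import Relation.Binary.Structures using (IsPartialOrder)
open import Relation.Nullary.Negation.Core using (¬_)
open import Relation.Unary using (Pred)
open import Relation.Unary.Relation.Binary.Equality using (≐-setoid)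

private
  variable
    a ℓ : Level
    A : Set a

------------------------------------------------------------------------
-- Real numbers, as Cauchy sequences of rationals

Eventually : Pred ℕ ℓ → Set ℓ
Eventually P = ∃ λ N → ∀ n → N ℕ.≤ n → P n

record ℝ : Set where
  constructor mkℝ
  field
    seq    : ℕ → ℚ
    cauchy : ∀ ε → 0ℚ ℚ.< ε →
             ∃ λ N → ∀ m n → N ℕ.≤ m → N ℕ.≤ n → ∣ seq m ℚ.- seq n ∣ ℚ.≤ ε

open ℝ public

infix 4 _≤_ _≃_

record _≤_ (x y : ℝ) : Set where
  constructor mk≤
  field
    eventually : ∀ ε → 0ℚ ℚ.< ε → Eventually λ n → seq x n ℚ.≤ seq y n ℚ.+ ε

open _≤_ public

_≃_ : Rel ℝ _
x ≃ y = x ≤ y × y ≤ x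

private
  0<½* : ∀ {ε} → 0ℚ ℚ.< ε → 0ℚ ℚ.< ½ ℚ.* ε
  0<½* = ℚ.*-monoʳ-<-pos ½

  ½*+½* : ∀ ε → ½ ℚ.* ε ℚ.+ ½ ℚ.* ε ≡ ε
  ½*+½* = solve 1 (λ ε → con ½ :* ε :+ con ½ :* ε := ε) refl
    where open +-*-Solver

  +-telescope : ∀ a b → a ≡ (a ℚ.- b) ℚ.+ b
  +-telescope = solve 2 (λ a b → a := (a :- b) :+ b) refl
    where open +-*-Solver

  +-interchange : ∀ a b c d → (a ℚ.+ b) ℚ.- (c ℚ.+ d) ≡ (a ℚ.- c) ℚ.+ (b ℚ.- d)
  +-interchange = solve 4 (λ a b c d → (a :+ b) :- (c :+ d) := (a :- c) :+ (b :- d)) refl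
    where open +-*-Solver

  *-telescope : ∀ a b c d →
                a ℚ.* b ℚ.- c ℚ.* d ≡ (b ℚ.- d) ℚ.* a ℚ.+ (a ℚ.- c) ℚ.* d
  *-telescope = solve 4
    (λ a b c d → a :* b :- c :* d := (b :- d) :* a :+ (a :- c) :* d) refl
    where open +-*-Solver

  ≤-refl : ∀ {x} → x ≤ x
  ≤-refl {x} = mk≤ λ ε 0<ε → 0 , λ n _ → begin
    seq x n         ≡⟨ ℚ.+-identityʳ _ ⟨
    seq x n ℚ.+ 0ℚ  ≤⟨ ℚ.+-monoʳ-≤ (seq x n) (ℚ.<⇒≤ 0<ε) ⟩
    seq x n ℚ.+ _   ∎
    where open ℚ.≤-Reasoning

  ≤-trans : ∀ {x y z} → x ≤ y → y ≤ z → x ≤ z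
  ≤-trans {x} {y} {z} x≤y y≤z = mk≤ λ ε 0<ε →
    let M , p = eventually x≤y (½ ℚ.* ε) (0<½* 0<ε)
        N , q = eventually y≤z (½ ℚ.* ε) (0<½* 0<ε)
    in M ℕ.⊔ N , λ n M⊔N≤n → begin
    seq x n
      ≤⟨ p n (ℕ.m⊔n≤o⇒m≤o M N M⊔N≤n) ⟩
    seq y n ℚ.+ ½ ℚ.* ε
      ≤⟨ ℚ.+-monoˡ-≤ (½ ℚ.* ε) (q n (ℕ.m⊔n≤o⇒n≤o M N M⊔N≤n)) ⟩
    seq z n ℚ.+ ½ ℚ.* ε ℚ.+ ½ ℚ.* ε
      ≡⟨ ℚ.+-assoc (seq z n) _ _ ⟩
    seq z n ℚ.+ (½ ℚ.* ε ℚ.+ ½ ℚ.* ε)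
      ≡⟨ cong (seq z n ℚ.+_) (½*+½* ε) ⟩
    seq z n ℚ.+ ε ∎
    where open ℚ.≤-Reasoning

≤-isPartialOrder : IsPartialOrder _≃_ _≤_
≤-isPartialOrder = record
  { isPreorder = record
    { isEquivalence = record
      { refl  = ≤-refl , ≤-refl
      ; sym   = swap
      ; trans = λ (p , p′) (q , q′) → ≤-trans p q , ≤-trans q′ p′
      }
    ; reflexive = proj₁
    ; trans     = ≤-trans
    }
  ; antisym = _,_
  }

fromℚ : ℚ → ℝ
fromℚ p = mkℝ (λ _ → p) λ ε 0<ε → 0 , λ _ _ _ _ →
  subst (λ r → ∣ r ∣ ℚ.≤ ε) (sym (ℚ.+-inverseʳ p)) (ℚ.<⇒≤ 0<ε)

fromℕ : ℕ → ℝ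
fromℕ n = fromℚ (+ n ℚ./ 1)

0ℝ 1ℝ : ℝ
0ℝ = fromℚ 0ℚ
1ℝ = fromℚ 1ℚ

infixl 6 _+_
infixl 7 _*_
infixr 8 _^_

_+_ : ℝ → ℝ → ℝ
x + y = mkℝ (λ n → seq x n ℚ.+ seq y n) prf
  where
  open ℚ.≤-Reasoning
  prf : ∀ ε → 0ℚ ℚ.< ε → ∃ λ N → ∀ m n → N ℕ.≤ m → N ℕ.≤ n →
        ∣ (seq x m ℚ.+ seq y m) ℚ.- (seq x n ℚ.+ seq y n) ∣ ℚ.≤ ε
  prf ε 0<ε
    with M , p ← cauchy x (½ ℚ.* ε) (0<½* 0<ε)
       | N , q ← cauchy y (½ ℚ.* ε) (0<½* 0<ε) = M ℕ.⊔ N , λ m n ≤m ≤n → begin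
    ∣ (seq x m ℚ.+ seq y m) ℚ.- (seq x n ℚ.+ seq y n) ∣
      ≡⟨ cong ∣_∣ (+-interchange (seq x m) (seq y m) (seq x n) (seq y n)) ⟩
    ∣ (seq x m ℚ.- seq x n) ℚ.+ (seq y m ℚ.- seq y n) ∣
      ≤⟨ ℚ.∣p+q∣≤∣p∣+∣q∣ (seq x m ℚ.- seq x n) (seq y m ℚ.- seq y n) ⟩
    ∣ seq x m ℚ.- seq x n ∣ ℚ.+ ∣ seq y m ℚ.- seq y n ∣
      ≤⟨ ℚ.+-mono-≤ (p m n (ℕ.m⊔n≤o⇒m≤o M N ≤m) (ℕ.m⊔n≤o⇒m≤o M N ≤n))
                    (q m n (ℕ.m⊔n≤o⇒n≤o M N ≤m) (ℕ.m⊔n≤o⇒n≤o M N ≤n)) ⟩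
    ½ ℚ.* ε ℚ.+ ½ ℚ.* ε
      ≡⟨ ½*+½* ε ⟩
    ε ∎

bounded : ∀ x → ∃ λ B → 0ℚ ℚ.< B × Eventually λ n → ∣ seq x n ∣ ℚ.≤ B
bounded x with N , p ← cauchy x 1ℚ (ℚ.positive⁻¹ 1ℚ) =
  1ℚ ℚ.+ ∣ seq x N ∣ ,
  ℚ.+-mono-<-≤ (ℚ.positive⁻¹ 1ℚ) (ℚ.0≤∣p∣ (seq x N)) ,
  N , λ n N≤n → begin
    ∣ seq x n ∣
      ≡⟨ cong ∣_∣ (+-telescope (seq x n) (seq x N)) ⟩
    ∣ (seq x n ℚ.- seq x N) ℚ.+ seq x N ∣
      ≤⟨ ℚ.∣p+q∣≤∣p∣+∣q∣ (seq x n ℚ.- seq x N) (seq x N) ⟩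
    ∣ seq x n ℚ.- seq x N ∣ ℚ.+ ∣ seq x N ∣
      ≤⟨ ℚ.+-monoˡ-≤ ∣ seq x N ∣ (p n N N≤n ℕ.≤-refl) ⟩
    1ℚ ℚ.+ ∣ seq x N ∣ ∎
  where
  open ℚ.≤-Reasoning

private
  divide : ∀ ε C → 0ℚ ℚ.< ε → 0ℚ ℚ.< C → ∃ λ η → 0ℚ ℚ.< η × η ℚ.* C ≡ ε
  divide ε C 0<ε 0<C =
    ε ℚ.* (ℚ.1/ C) ,
    ℚ.positive⁻¹ (ε ℚ.* (ℚ.1/ C)) {{ℚ.pos*pos⇒pos ε (ℚ.1/ C)}} ,
    (begin
      ε ℚ.* (ℚ.1/ C) ℚ.* C    ≡⟨ ℚ.*-assoc ε (ℚ.1/ C) C ⟩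
      ε ℚ.* ((ℚ.1/ C) ℚ.* C)  ≡⟨ cong (ε ℚ.*_) (ℚ.*-inverseˡ C) ⟩
      ε ℚ.* 1ℚ                ≡⟨ ℚ.*-identityʳ ε ⟩
      ε                       ∎)
    where
    open ≡-Reasoning
    instance
      _ = ℚ.positive 0<ε
      _ = ℚ.positive 0<C
      _ = ℚ.pos⇒nonZero C
      _ = ℚ.1/pos⇒pos C

  *-mono-≤ : ∀ {p q r s} → 0ℚ ℚ.≤ q → 0ℚ ℚ.≤ r →
             p ℚ.≤ q → r ℚ.≤ s → p ℚ.* r ℚ.≤ q ℚ.* s
  *-mono-≤ {p} {q} {r} {s} 0≤q 0≤r p≤q r≤s = ℚ.≤-trans
    (ℚ.*-monoʳ-≤-nonNeg r {{ℚ.nonNegative 0≤r}} p≤q)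
    (ℚ.*-monoˡ-≤-nonNeg q {{ℚ.nonNegative 0≤q}} r≤s)

  ∣ab-cd∣≤η[B+C] : ∀ a b c d {B C η} → 0ℚ ℚ.≤ η →
                   ∣ a ∣ ℚ.≤ B → ∣ d ∣ ℚ.≤ C →
                   ∣ a ℚ.- c ∣ ℚ.≤ η → ∣ b ℚ.- d ∣ ℚ.≤ η →
                   ∣ a ℚ.* b ℚ.- c ℚ.* d ∣ ℚ.≤ η ℚ.* (B ℚ.+ C)
  ∣ab-cd∣≤η[B+C] a b c d {B} {C} {η} 0≤η a≤B d≤C a-c≤η b-d≤η = begin
    ∣ a ℚ.* b ℚ.- c ℚ.* d ∣
      ≡⟨ cong ∣_∣ (*-telescope a b c d) ⟩
    ∣ (b ℚ.- d) ℚ.* a ℚ.+ (a ℚ.- c) ℚ.* d ∣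
      ≤⟨ ℚ.∣p+q∣≤∣p∣+∣q∣ ((b ℚ.- d) ℚ.* a) ((a ℚ.- c) ℚ.* d) ⟩
    ∣ (b ℚ.- d) ℚ.* a ∣ ℚ.+ ∣ (a ℚ.- c) ℚ.* d ∣
      ≡⟨ cong₂ ℚ._+_ (ℚ.∣p*q∣≡∣p∣*∣q∣ (b ℚ.- d) a) (ℚ.∣p*q∣≡∣p∣*∣q∣ (a ℚ.- c) d) ⟩
    ∣ b ℚ.- d ∣ ℚ.* ∣ a ∣ ℚ.+ ∣ a ℚ.- c ∣ ℚ.* ∣ d ∣
      ≤⟨ ℚ.+-mono-≤ (*-mono-≤ 0≤η (ℚ.0≤∣p∣ a) b-d≤η a≤B)
                    (*-mono-≤ 0≤η (ℚ.0≤∣p∣ d) a-c≤η d≤C) ⟩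
    η ℚ.* B ℚ.+ η ℚ.* C
      ≡⟨ ℚ.*-distribˡ-+ η B C ⟨
    η ℚ.* (B ℚ.+ C) ∎
    where open ℚ.≤-Reasoning

  module Product
    (x y : ℝ) (ε : ℚ) {B C η : ℚ} (0<η : 0ℚ ℚ.< η) (η*[B+C]≡ε : η ℚ.* (B ℚ.+ C) ≡ ε)
    where
    close : (Eventually λ n → ∣ seq x n ∣ ℚ.≤ B) →
            (Eventually λ n → ∣ seq y n ∣ ℚ.≤ C) →
            ∃ λ N → ∀ m n → N ℕ.≤ m → N ℕ.≤ n →
            ∣ seq x m ℚ.* seq y m ℚ.- seq x n ℚ.* seq y n ∣ ℚ.≤ ε
    close (K , b) (L , c) =
      let M , p = cauchy x η 0<η
          N , q = cauchy y η 0<η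
      in (K ℕ.⊔ L) ℕ.⊔ (M ℕ.⊔ N) , λ m n ≤m ≤n →
      let K⊔L≤m = ℕ.m⊔n≤o⇒m≤o (K ℕ.⊔ L) (M ℕ.⊔ N) ≤m
          K⊔L≤n = ℕ.m⊔n≤o⇒m≤o (K ℕ.⊔ L) (M ℕ.⊔ N) ≤n
          M⊔N≤m = ℕ.m⊔n≤o⇒n≤o (K ℕ.⊔ L) (M ℕ.⊔ N) ≤m
          M⊔N≤n = ℕ.m⊔n≤o⇒n≤o (K ℕ.⊔ L) (M ℕ.⊔ N) ≤n
      in ℚ.≤-trans
           (∣ab-cd∣≤η[B+C] (seq x m) (seq y m) (seq x n) (seq y n) (ℚ.<⇒≤ 0<η)
             (b m (ℕ.m⊔n≤o⇒m≤o K L K⊔L≤m))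
             (c n (ℕ.m⊔n≤o⇒n≤o K L K⊔L≤n))
             (p m n (ℕ.m⊔n≤o⇒m≤o M N M⊔N≤m) (ℕ.m⊔n≤o⇒m≤o M N M⊔N≤n))
             (q m n (ℕ.m⊔n≤o⇒n≤o M N M⊔N≤m) (ℕ.m⊔n≤o⇒n≤o M N M⊔N≤n)))
           (ℚ.≤-reflexive η*[B+C]≡ε)

_*_ : ℝ → ℝ → ℝ
x * y = mkℝ (λ n → seq x n ℚ.* seq y n) λ ε 0<ε →
  let B , 0<B , b = bounded x
      C , 0<C , c = bounded y
      η , 0<η , eq = divide ε (B ℚ.+ C) 0<ε (ℚ.+-mono-< 0<B 0<C)
  in Product.close x y ε 0<η eq b c

_^_ : ℝ → ℕ → ℝ
x ^ zero  = 1ℝ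
x ^ suc k = x * x ^ k

-- Quotients and the power 2/3 are given by their defining equations, which
-- determine them uniquely: constructively, division would need a positive lower
-- bound on the absolute value of the divisor rather than just ¬ (y ≃ 0ℝ).

IsQuotient : (x y z : ℝ) → Set
IsQuotient x y z = ¬ (y ≃ 0ℝ) × z * y ≃ x

-- t = x^(2/3), for x ≥ 0.
IsPowerTwoThirds : (x t : ℝ) → Set
IsPowerTwoThirds x t = 0ℝ ≤ x × 0ℝ ≤ t × t ^ 3 ≃ x ^ 2

------------------------------------------------------------------------
-- Metric spaces and their lines

IsMetric : Rel A ℓ → (A → A → ℝ) → Set _
IsMetric _≈_ d = Metric.IsGeneralMetric _≈_ _≃_ _≤_ 0ℝ _+_ d

-- That the extremal distances are attained, and that the lines have some
-- cardinality, holds constructively only up to double negation, comparison of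
-- reals being undecidable. As x ≤ y is stable under double negation, a bound
-- x ≤ y derived from such data loses nothing by taking them as hypotheses.

module _ {X : Set a} (d : X → X → ℝ) where

  IsLargestDistance : ℝ → Set a
  IsLargestDistance D = (∃₂ λ x y → d x y ≃ D) × (∀ x y → d x y ≤ D)

  IsSmallestNonzeroDistance : ℝ → Set a
  IsSmallestNonzeroDistance δ =
    (∃₂ λ x y → d x y ≃ δ) × ¬ (δ ≃ 0ℝ) ×
    (∀ x y → ¬ (d x y ≃ 0ℝ) → δ ≤ d x y)

  IsDistanceRatio : ℝ → Set a
  IsDistanceRatio ρ = ∃₂ λ D δ →
    IsLargestDistance D × IsSmallestNonzeroDistance δ × IsQuotient D δ ρ

  [_,_,_] : X → X → X → Set a
  [ x , y , z ] = (x ≢ y × y ≢ z × x ≢ z) × d x y + d y z ≃ d x z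

  line : X → X → Pred X a
  line u v p = [ p , u , v ] ⊎ p ≡ u ⊎ [ u , p , v ] ⊎ p ≡ v ⊎ [ u , v , p ]

  -- The lines as subsets of X: pairs of distinct points generating the same
  -- subset are identified.
  lines : Setoid a a
  lines = On.setoid {B = ∃₂ λ (u v : X) → u ≢ v} (≐-setoid X a)
            λ (u , v , _) → line u v

HasCardinality : Setoid a ℓ → ℕ → Set _
HasCardinality S m = Bijection (setoid (Fin m)) S

{-# OPTIONS --safe #-}
module Submission where

-- Fix a point x and colour every other point y by the line xy together with the
-- integer ⌊d(x,y)/δ⌋, which takes at most B ≤ D/δ = ρ values.  Two points y, z of
-- the same colour are collinear with x, and neither [xyz] nor [xzy] holds because
-- d(y,z) ≥ δ, so [yxz].  Points of one colour thus form a star centred at x, in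
-- which no three are collinear, so that distinct pairs generate distinct lines.
-- With m lines and r = ⌊√m⌋, a colour class therefore has fewer than 2(r + 1)
-- points, and n ≤ 1 + (2r + 1)mB gives n² ≤ 36 m³B² ≤ 36 m³ρ², whereas
-- m < t/4 would give 64 m³ρ² ≤ n².
--
-- As ≤ on ℝ is stable under double negation, the undecidable choice of the
-- integers ⌊d(x,y)/δ⌋ may be made under a double negation.

open import Defs
open import Data.Empty using (⊥)
open import Data.Fin.Base
  using (Fin; zero; suc; toℕ; fromℕ<; inject≤; combine; remQuot; splitAt; _↑ˡ_; _↑ʳ_)
import Data.Fin.Properties as Fin
open import Data.Integer.Base as ℤ using (+_)
import Data.Integer.Properties as ℤ
open import Data.List.Base using (List; []; _∷_; length; filter; lookup; allFin)
import Data.List.Membership.Propositional.Properties as ∈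
import Data.List.Properties as List
open import Data.List.Relation.Unary.All as All using (All; []; _∷_)
import Data.List.Relation.Unary.All.Properties as All
open import Data.List.Relation.Unary.Unique.Propositional using (Unique; []; _∷_)
import Data.List.Relation.Unary.Unique.Propositional.Properties as Unique
open import Data.Nat.Base as ℕ using (ℕ; zero; suc)
import Data.Nat.Coprimality as Coprime
import Data.Nat.Properties as ℕ
import Data.Nat.Tactic.RingSolver as ℕ-Solver
open import Data.Product.Base as Product using (∃; ∃₂; _×_; _,_; proj₁; proj₂; uncurry)
open import Data.Rational.Base as ℚ using (ℚ; 0ℚ; 1ℚ; ½; ∣_∣)
import Data.Rational.Properties as ℚ
import Data.Rational.Solver as ℚ-Solver
open import Data.Sum.Base as Sum using (_⊎_; inj₁; inj₂; fromInj₁)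
open import Effect.Monad using (RawMonad)
open import Function.Base using (_∘_)
open import Function.Bundles using (_↔_; Inverse; Bijection; module Injection)
open import Function.Definitions using (Injective)
import Function.Metric.Structures as Metric
open import Function.Properties.Inverse using (↔⇒↣)
open import Level using (Level)
open import Relation.Binary.Bundles using (Setoid)
import Relation.Binary.Construct.On as On
open import Relation.Binary.PropositionalEquality
  using (_≡_; _≢_; refl; sym; trans; cong; cong₂; subst)
open import Relation.Binary.Structures using (IsPartialOrder)
open import Relation.Nullary using (¬_; contradiction; yes; no; ¬?)
open import Relation.Nullary.Negation using (¬¬-Monad)
open import Relation.Unary using (Pred; Decidable; _⊆_; _≐_)
open import Relation.Unary.Relation.Binary.Equality using (≐-setoid)

open IsPartialOrder ≤-isPartialOrder using () renaming (refl to ≤-refl; trans to ≤-trans)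

private
  variable
    a p : Level
    A : Set a
    x y z w : ℝ

-- Real numbers

open ℚ-Solver.+-*-Solver using (solve; con; _:=_; _:+_; _:*_; _:-_; :-_)

-- Linear inequalities are proved by exhibiting the slack `r`, built from the slacks of the
-- hypotheses; what remains is a ring identity for the solver.
≤-witness : ∀ {p q} r → 0ℚ ℚ.≤ r → q ≡ p ℚ.+ r → p ℚ.≤ q
≤-witness {p} {q} r 0≤r q≡p+r = begin
  p           ≡⟨ ℚ.+-identityʳ p ⟨
  p ℚ.+ 0ℚ    ≤⟨ ℚ.+-monoʳ-≤ p 0≤r ⟩
  p ℚ.+ r     ≡⟨ q≡p+r ⟨
  q           ∎
  where open ℚ.≤-Reasoning

0≤+ : ∀ {p q} → 0ℚ ℚ.≤ p → 0ℚ ℚ.≤ q → 0ℚ ℚ.≤ p ℚ.+ q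
0≤+ = ℚ.+-mono-≤

0≤* : ∀ {p q} → 0ℚ ℚ.≤ p → 0ℚ ℚ.≤ q → 0ℚ ℚ.≤ p ℚ.* q
0≤* {p} {q} 0≤p 0≤q = subst (ℚ._≤ p ℚ.* q) (ℚ.*-zeroˡ q)
  (ℚ.*-monoʳ-≤-nonNeg q {{ℚ.nonNegative 0≤q}} 0≤p)

0≤- : ∀ {p q} → p ℚ.≤ q → 0ℚ ℚ.≤ q ℚ.- p
0≤- {p} {q} p≤q = subst (ℚ._≤ q ℚ.- p) (ℚ.+-inverseʳ p) (ℚ.+-monoˡ-≤ (ℚ.- p) p≤q)

0<½* : ∀ {ε} → 0ℚ ℚ.< ε → 0ℚ ℚ.< ½ ℚ.* ε
0<½* = ℚ.*-monoʳ-<-pos ½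

divide : ∀ {ε C} → 0ℚ ℚ.< ε → 0ℚ ℚ.< C → ∃ λ η → 0ℚ ℚ.< η × η ℚ.* C ≡ ε
divide {ε} {C} 0<ε 0<C =
  ε ℚ.* (ℚ.1/ C) ,
  ℚ.positive⁻¹ (ε ℚ.* (ℚ.1/ C)) {{ℚ.pos*pos⇒pos ε (ℚ.1/ C)}} ,
  trans (ℚ.*-assoc ε (ℚ.1/ C) C)
    (trans (cong (ε ℚ.*_) (ℚ.*-inverseˡ C)) (ℚ.*-identityʳ ε))
  where
  instance
    _ = ℚ.positive 0<ε
    _ = ℚ.positive 0<C
    _ = ℚ.pos⇒nonZero C
    _ = ℚ.1/pos⇒pos C

p≤∣p∣ : ∀ p → p ℚ.≤ ∣ p ∣
p≤∣p∣ p with ℚ.≤-total 0ℚ p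
... | inj₁ 0≤p = ℚ.≤-reflexive (sym (ℚ.0≤p⇒∣p∣≡p 0≤p))
... | inj₂ p≤0 = ℚ.≤-trans p≤0 (ℚ.0≤∣p∣ p)

-- Eventual properties of Cauchy sequences

zipEventually : ∀ {p q r} {P : Pred ℕ p} {Q : Pred ℕ q} {R : Pred ℕ r} →
                (∀ {n} → P n → Q n → R n) →
                Eventually P → Eventually Q → Eventually R
zipEventually f (M , p) (N , q) = M ℕ.⊔ N , λ n M⊔N≤n →
  f (p n (ℕ.m⊔n≤o⇒m≤o M N M⊔N≤n)) (q n (ℕ.m⊔n≤o⇒n≤o M N M⊔N≤n))

mapEventually : ∀ {p q} {P : Pred ℕ p} {Q : Pred ℕ q} →
                (∀ {n} → P n → Q n) → Eventually P → Eventually Q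
mapEventually f = Product.map₂ λ p n N≤n → f (p n N≤n)

-- The Cauchy condition as one-sided bounds, the linear form that `≤-witness` handles.
settled : ∀ x ε → 0ℚ ℚ.< ε → Eventually λ m → ∀ n → m ℕ.≤ n →
          seq x m ℚ.≤ seq x n ℚ.+ ε × seq x n ℚ.≤ seq x m ℚ.+ ε
settled x ε 0<ε with N , p ← cauchy x ε 0<ε = N , λ m N≤m n m≤n →
  let N≤n = ℕ.≤-trans N≤m m≤n
  in bound (seq x m) (seq x n) (p m n N≤m N≤n) , bound (seq x n) (seq x m) (p n m N≤n N≤m)
  where
  bound : ∀ a b → ∣ a ℚ.- b ∣ ℚ.≤ ε → a ℚ.≤ b ℚ.+ ε
  bound a b ∣a-b∣≤ε = ≤-witness _ (0≤- (ℚ.≤-trans (p≤∣p∣ (a ℚ.- b)) ∣a-b∣≤ε))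
    (solve 3 (λ a b ε → b :+ ε := a :+ (ε :- (a :- b))) refl a b ε)

-- Strict order and stability of `≤`

infix 4 _<_

-- The explicit rational gap makes this a positive notion whose negation is the reverse `≤`;
-- stability of `≤` follows from that.
_<_ : ℝ → ℝ → Set
x < y = ∃ λ ε → 0ℚ ℚ.< ε × Eventually λ n → seq x n ℚ.+ ε ℚ.≤ seq y n

<⇒≤ : x < y → x ≤ y
<⇒≤ {x} {y} (η , 0<η , x+η≤y) = mk≤ λ ε 0<ε →
  mapEventually (weaken (ℚ.<⇒≤ 0<ε) (seq x _) (seq y _)) x+η≤y
  where
  weaken : ∀ {ε} → 0ℚ ℚ.≤ ε → ∀ a b → a ℚ.+ η ℚ.≤ b → a ℚ.≤ b ℚ.+ ε
  weaken {ε} 0≤ε a b a+η≤b = ≤-witness _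
    (0≤+ (0≤- a+η≤b) (0≤+ (ℚ.<⇒≤ 0<η) 0≤ε))
    (solve 4 (λ a b η ε → b :+ ε := a :+ ((b :- (a :+ η)) :+ (η :+ ε))) refl a b η ε)

<⇒≱ : x < y → ¬ (y ≤ x)
<⇒≱ {x} {y} (η , 0<η , x+η≤y) y≤x =
  let N , p = zipEventually {R = λ _ → ½ ℚ.* η ℚ.≤ 0ℚ} (absurd (seq x _) (seq y _))
                x+η≤y (eventually y≤x (½ ℚ.* η) (0<½* 0<η))
  in ℚ.<-irrefl refl (ℚ.<-≤-trans (0<½* 0<η) (p N ℕ.≤-refl))
  where
  absurd : ∀ a b → a ℚ.+ η ℚ.≤ b → b ℚ.≤ a ℚ.+ ½ ℚ.* η → ½ ℚ.* η ℚ.≤ 0ℚ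
  absurd a b p q = ≤-witness _ (0≤+ (0≤- p) (0≤- q))
    (solve 3 (λ a b η → con 0ℚ :=
        con ½ :* η :+ ((b :- (a :+ η)) :+ (a :+ con ½ :* η :- b)))
      refl a b η)

-- Constructive substitute for deciding the order: at one settled index `K` the rationals `seq x K`
-- and `seq y K` plus `¾ε` are comparable. Later terms drift by at most `⅛ε` each, so `x` stays
-- within `ε` above `y` in one case, and a gap of `½ε` survives in the other.
compare : ∀ x y ε → 0ℚ ℚ.< ε → (Eventually λ n → seq x n ℚ.≤ seq y n ℚ.+ ε) ⊎ y < x
compare x y ε 0<ε =
  let K , p = zipEventually _,_ (settled x ⅛ε 0<⅛ε) (settled y ⅛ε 0<⅛ε)
      xK~ , yK~ = p K ℕ.≤-refl
  in Sum.map
       (λ xK≤yK+¾ε → K , λ n K≤n → upper (seq x n) (seq x K) (seq y n) (seq y K)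
         (proj₂ (xK~ n K≤n)) (proj₁ (yK~ n K≤n)) xK≤yK+¾ε)
       (λ yK+¾ε≤xK → ½ ℚ.* ε , 0<½* 0<ε , K , λ n K≤n →
         lower (seq x n) (seq x K) (seq y n) (seq y K)
         (proj₁ (xK~ n K≤n)) (proj₂ (yK~ n K≤n)) yK+¾ε≤xK)
       (ℚ.≤-total (seq x K) (seq y K ℚ.+ ¾ε))
  where
  ⅛ε = ½ ℚ.* (½ ℚ.* (½ ℚ.* ε))
  ¾ε = ½ ℚ.* ε ℚ.+ ½ ℚ.* (½ ℚ.* ε)

  0<⅛ε : 0ℚ ℚ.< ⅛ε
  0<⅛ε = 0<½* (0<½* (0<½* 0<ε))

  upper : ∀ xn xK yn yK → xn ℚ.≤ xK ℚ.+ ⅛ε → yK ℚ.≤ yn ℚ.+ ⅛ε →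
          xK ℚ.≤ yK ℚ.+ ¾ε → xn ℚ.≤ yn ℚ.+ ε
  upper xn xK yn yK p q r = ≤-witness _ (0≤+ (0≤+ (0≤- p) (0≤- q)) (0≤- r))
    (solve 5 (λ xn xK yn yK ε → yn :+ ε :=
       xn :+ ((xK :+ con ½ :* (con ½ :* (con ½ :* ε)) :- xn)
          :+ (yn :+ con ½ :* (con ½ :* (con ½ :* ε)) :- yK)
          :+ (yK :+ (con ½ :* ε :+ con ½ :* (con ½ :* ε)) :- xK)))
       refl xn xK yn yK ε)

  lower : ∀ xn xK yn yK → xK ℚ.≤ xn ℚ.+ ⅛ε → yn ℚ.≤ yK ℚ.+ ⅛ε →
          yK ℚ.+ ¾ε ℚ.≤ xK → yn ℚ.+ ½ ℚ.* ε ℚ.≤ xn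
  lower xn xK yn yK p q r = ≤-witness _ (0≤+ (0≤+ (0≤- p) (0≤- q)) (0≤- r))
    (solve 5 (λ xn xK yn yK ε → xn :=
       yn :+ con ½ :* ε
          :+ ((xn :+ con ½ :* (con ½ :* (con ½ :* ε)) :- xK)
          :+ (yK :+ con ½ :* (con ½ :* (con ½ :* ε)) :- yn)
          :+ (xK :- (yK :+ (con ½ :* ε :+ con ½ :* (con ½ :* ε))))))
       refl xn xK yn yK ε)

≮⇒≥ : ¬ (y < x) → x ≤ y
≮⇒≥ {y} {x} y≮x = mk≤ λ ε 0<ε →
  fromInj₁ (λ y<x → contradiction y<x y≮x) (compare x y ε 0<ε)

≤-stable : ¬ ¬ (x ≤ y) → x ≤ y
≤-stable ¬¬x≤y = ≮⇒≥ λ y<x → ¬¬x≤y (<⇒≱ y<x)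

≰⇒≥ : ¬ (x ≤ y) → y ≤ x
≰⇒≥ x≰y = ≮⇒≥ λ x<y → x≰y (<⇒≤ x<y)

-- Compatibility of `≤` with addition and multiplication

≤-pointwise : (∀ n → seq x n ℚ.≤ seq y n) → x ≤ y
≤-pointwise {x} {y} x≤y = mk≤ λ ε 0<ε → 0 , λ n _ →
  ℚ.≤-trans (x≤y n) (≤-witness ε (ℚ.<⇒≤ 0<ε) refl)

≡⇒≤ : (∀ n → seq x n ≡ seq y n) → x ≤ y
≡⇒≤ x≡y = ≤-pointwise λ n → ℚ.≤-reflexive (x≡y n)

+-mono-≤ : x ≤ y → z ≤ w → x + z ≤ y + w
+-mono-≤ {x} {y} {z} {w} x≤y z≤w = mk≤ λ ε 0<ε → zipEventually
  (add ε (seq x _) (seq y _) (seq z _) (seq w _))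
  (eventually x≤y (½ ℚ.* ε) (0<½* 0<ε)) (eventually z≤w (½ ℚ.* ε) (0<½* 0<ε))
  where
  add : ∀ ε a b c d → a ℚ.≤ b ℚ.+ ½ ℚ.* ε → c ℚ.≤ d ℚ.+ ½ ℚ.* ε →
        a ℚ.+ c ℚ.≤ b ℚ.+ d ℚ.+ ε
  add ε a b c d p q = ≤-witness _ (0≤+ (0≤- p) (0≤- q))
    (solve 5 (λ a b c d ε → b :+ d :+ ε :=
        a :+ c :+ ((b :+ con ½ :* ε :- a) :+ (d :+ con ½ :* ε :- c)))
      refl a b c d ε)

+-cancelˡ-≤ : ∀ x → x + y ≤ x + z → y ≤ z
+-cancelˡ-≤ {y} {z} x x+y≤x+z = mk≤ λ ε 0<ε →
  mapEventually (cancel ε (seq x _) (seq y _) (seq z _)) (eventually x+y≤x+z ε 0<ε)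
  where
  cancel : ∀ ε a b c → a ℚ.+ b ℚ.≤ a ℚ.+ c ℚ.+ ε → b ℚ.≤ c ℚ.+ ε
  cancel ε a b c p = ≤-witness _ (0≤- p)
    (solve 4 (λ a b c ε → c :+ ε := b :+ (a :+ c :+ ε :- (a :+ b))) refl a b c ε)

∣p∣≤q⇒p,-p≤q : ∀ p {q} → ∣ p ∣ ℚ.≤ q → p ℚ.≤ q × ℚ.- p ℚ.≤ q
∣p∣≤q⇒p,-p≤q p {q} ∣p∣≤q =
  ℚ.≤-trans (p≤∣p∣ p) ∣p∣≤q ,
  ℚ.≤-trans (p≤∣p∣ (ℚ.- p)) (ℚ.≤-trans (ℚ.≤-reflexive (ℚ.∣-p∣≡∣p∣ p)) ∣p∣≤q)

Bounded : ℝ → ℚ → Set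
Bounded x B = Eventually λ n → seq x n ℚ.≤ B × ℚ.- seq x n ℚ.≤ B

bounds : ∀ x → ∃ λ B → 0ℚ ℚ.< B × Bounded x B
bounds x = Product.map₂ (Product.map₂ (mapEventually (∣p∣≤q⇒p,-p≤q (seq x _)))) (bounded x)

-- Termwise, `0ℝ ≤ z` and `x ≤ y` hold only up to errors `η` and `ζ`. Expanding (b + ζ - a)(c + η) ≥
-- 0 leaves error terms that boundedness of the sequences makes small.
*-monoʳ-≤-nonNeg : ∀ x y z → 0ℝ ≤ z → x ≤ y → x * z ≤ y * z
*-monoʳ-≤-nonNeg x y z 0≤z x≤y = mk≤ λ ε 0<ε →
  let A , 0<A , x≤A = bounds x
      B , 0<B , y≤B = bounds y
      C , 0<C , z≤C = bounds z
      -- `η` is chosen before `ζ` because the error term with factor `ζ` contains `η`; each of the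
      -- two terms takes half of `ε`.
      η , 0<η , η[B+A]≡½ε = divide (0<½* 0<ε) (ℚ.+-mono-< 0<B 0<A)
      ζ , 0<ζ , ζ[C+η]≡½ε = divide (0<½* 0<ε) (ℚ.+-mono-< 0<C 0<η)
  in within ε 0<η 0<ζ η[B+A]≡½ε ζ[C+η]≡½ε x≤A y≤B z≤C
  where
  ½*+½* : ∀ ε → ½ ℚ.* ε ℚ.+ ½ ℚ.* ε ≡ ε
  ½*+½* = solve 1 (λ ε → con ½ :* ε :+ con ½ :* ε := ε) refl

  expand : ∀ a b c {A B C η ζ} → 0ℚ ℚ.≤ η → 0ℚ ℚ.≤ ζ →
           a ℚ.≤ b ℚ.+ ζ → 0ℚ ℚ.≤ c ℚ.+ η → ℚ.- a ℚ.≤ A → b ℚ.≤ B → c ℚ.≤ C →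
           a ℚ.* c ℚ.≤ b ℚ.* c ℚ.+ (η ℚ.* (B ℚ.+ A) ℚ.+ ζ ℚ.* (C ℚ.+ η))
  expand a b c {A} {B} {C} {η} {ζ} 0≤η 0≤ζ p q r s t = begin
    a ℚ.* c
      ≤⟨ ≤-witness _ (0≤* (0≤- p) q)
           (solve 5 (λ a b c η ζ → b :* c :+ (η :* (b :+ :- a) :+ ζ :* (c :+ η)) :=
               a :* c :+ (b :+ ζ :- a) :* (c :+ η))
             refl a b c η ζ) ⟩
    b ℚ.* c ℚ.+ (η ℚ.* (b ℚ.+ ℚ.- a) ℚ.+ ζ ℚ.* (c ℚ.+ η))
      ≤⟨ ℚ.+-monoʳ-≤ (b ℚ.* c) (ℚ.+-mono-≤
           (ℚ.*-monoˡ-≤-nonNeg η {{ℚ.nonNegative 0≤η}} (ℚ.+-mono-≤ s r))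
           (ℚ.*-monoˡ-≤-nonNeg ζ {{ℚ.nonNegative 0≤ζ}} (ℚ.+-monoˡ-≤ η t))) ⟩
    b ℚ.* c ℚ.+ (η ℚ.* (B ℚ.+ A) ℚ.+ ζ ℚ.* (C ℚ.+ η)) ∎
    where open ℚ.≤-Reasoning

  within : ∀ ε {A B C η ζ} → 0ℚ ℚ.< η → 0ℚ ℚ.< ζ →
           η ℚ.* (B ℚ.+ A) ≡ ½ ℚ.* ε → ζ ℚ.* (C ℚ.+ η) ≡ ½ ℚ.* ε →
           Bounded x A → Bounded y B → Bounded z C →
           Eventually λ n → seq x n ℚ.* seq z n ℚ.≤ seq y n ℚ.* seq z n ℚ.+ ε
  within ε {η = η} {ζ} 0<η 0<ζ η[B+A]≡½ε ζ[C+η]≡½ε x≤A y≤B z≤C = zipEventually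
    (λ {n} (p , q) ((_ , r) , (s , _) , (t , _)) → ℚ.≤-trans
      (expand (seq x n) (seq y n) (seq z n) (ℚ.<⇒≤ 0<η) (ℚ.<⇒≤ 0<ζ) p q r s t)
      (ℚ.+-monoʳ-≤ (seq y n ℚ.* seq z n)
        (ℚ.≤-reflexive (trans (cong₂ ℚ._+_ η[B+A]≡½ε ζ[C+η]≡½ε) (½*+½* ε)))))
    (zipEventually _,_ (eventually x≤y ζ 0<ζ) (eventually 0≤z η 0<η))
    (zipEventually _,_ x≤A (zipEventually _,_ y≤B z≤C))

*-comm-≤ : ∀ x y → x * y ≤ y * x
*-comm-≤ x y = ≡⇒≤ {x * y} {y * x} λ n → ℚ.*-comm (seq x n) (seq y n)

module ≤-Reasoning where

  infix  1 begin_
  infixr 2 _≤⟨_⟩_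
  infix  3 _∎

  begin_ : x ≤ y → x ≤ y
  begin x≤y = x≤y

  _≤⟨_⟩_ : ∀ x → x ≤ y → y ≤ z → x ≤ z
  x ≤⟨ x≤y ⟩ y≤z = ≤-trans x≤y y≤z

  _∎ : ∀ x → x ≤ x
  x ∎ = ≤-refl

*-monoˡ-≤-nonNeg : ∀ z x y → 0ℝ ≤ z → x ≤ y → z * x ≤ z * y
*-monoˡ-≤-nonNeg z x y 0≤z x≤y = begin
  z * x   ≤⟨ *-comm-≤ z x ⟩
  x * z   ≤⟨ *-monoʳ-≤-nonNeg x y z 0≤z x≤y ⟩
  y * z   ≤⟨ *-comm-≤ y z ⟩
  z * y   ∎
  where open ≤-Reasoning

*-mono-≤ : ∀ x y z w → 0ℝ ≤ y → 0ℝ ≤ z → x ≤ y → z ≤ w → x * z ≤ y * w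
*-mono-≤ x y z w 0≤y 0≤z x≤y z≤w = begin
  x * z   ≤⟨ *-monoʳ-≤-nonNeg x y z 0≤z x≤y ⟩
  y * z   ≤⟨ *-monoˡ-≤-nonNeg y z w 0≤y z≤w ⟩
  y * w   ∎
  where open ≤-Reasoning

0≤x*y : ∀ x y → 0ℝ ≤ x → 0ℝ ≤ y → 0ℝ ≤ x * y
0≤x*y x y 0≤x 0≤y = begin
  0ℝ       ≤⟨ ≡⇒≤ {0ℝ} {0ℝ * y} (λ n → sym (ℚ.*-zeroˡ (seq y n))) ⟩
  0ℝ * y   ≤⟨ *-monoʳ-≤-nonNeg 0ℝ x y 0≤y 0≤x ⟩
  x * y    ∎
  where open ≤-Reasoning

-- With tolerance `ε * ε` in the hypothesis, a term p satisfies p² ≤ ε²; in the case ε ≤ p,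
-- cancelling `ε` from εp ≤ p² ≤ ε² gives p ≤ ε.
x*x≤0⇒x≤0 : x * x ≤ 0ℝ → x ≤ 0ℝ
x*x≤0⇒x≤0 {x} x*x≤0 = mk≤ λ ε 0<ε → mapEventually
  (λ {n} p → ℚ.≤-trans (root 0<ε (ℚ.≤-trans p (ℚ.≤-reflexive (ℚ.+-identityˡ _)))
                         (ℚ.≤-total (seq x n) ε))
                       (ℚ.≤-reflexive (sym (ℚ.+-identityˡ ε))))
  (eventually x*x≤0 (ε ℚ.* ε)
    (ℚ.positive⁻¹ (ε ℚ.* ε) {{ℚ.pos*pos⇒pos ε {{ℚ.positive 0<ε}} ε {{ℚ.positive 0<ε}}}}))
  where
  root : ∀ {p ε} → 0ℚ ℚ.< ε → p ℚ.* p ℚ.≤ ε ℚ.* ε → p ℚ.≤ ε ⊎ ε ℚ.≤ p → p ℚ.≤ ε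
  root _ _ (inj₁ p≤ε) = p≤ε
  root {p} {ε} 0<ε p²≤ε² (inj₂ ε≤p) = ℚ.*-cancelˡ-≤-pos ε {{ℚ.positive 0<ε}}
    (ℚ.≤-trans (ℚ.*-monoʳ-≤-nonNeg p {{ℚ.nonNegative (ℚ.≤-trans (ℚ.<⇒≤ 0<ε) ε≤p)}} ε≤p) p²≤ε²)

-- The natural numbers in ℚ and ℝ

natℚ : ℕ → ℚ
natℚ n = + n ℚ./ 1

-- The quotient by 1 is normalised through a gcd that is stuck for a variable `n`; the explicit
-- fraction computes, which reduces the arithmetic to that of integers.
natℚ≡mkℚ : ∀ n → natℚ n ≡ ℚ.mkℚ (+ n) 0 (Coprime.sym (Coprime.1-coprimeTo n))
natℚ≡mkℚ n = ℚ.↥p/↧p≡p (ℚ.mkℚ (+ n) 0 (Coprime.sym (Coprime.1-coprimeTo n)))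

natℚ-+ : ∀ m n → natℚ (m ℕ.+ n) ≡ natℚ m ℚ.+ natℚ n
natℚ-+ m n rewrite natℚ≡mkℚ m | natℚ≡mkℚ n =
  cong (ℚ._/ 1) (sym (cong₂ ℤ._+_ (ℤ.*-identityʳ (+ m)) (ℤ.*-identityʳ (+ n))))

natℚ-* : ∀ m n → natℚ (m ℕ.* n) ≡ natℚ m ℚ.* natℚ n
natℚ-* m n rewrite natℚ≡mkℚ m | natℚ≡mkℚ n = cong (ℚ._/ 1) (ℤ.pos-* m n)

natℚ-mono-≤ : ∀ {m n} → m ℕ.≤ n → natℚ m ℚ.≤ natℚ n
natℚ-mono-≤ {m} {n} m≤n rewrite natℚ≡mkℚ m | natℚ≡mkℚ n =
  ℚ.*≤* (ℤ.*-monoʳ-≤-nonNeg (+ 1) (ℤ.+≤+ m≤n))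

fromℕ-mono-≤ : ∀ {m n} → m ℕ.≤ n → fromℕ m ≤ fromℕ n
fromℕ-mono-≤ m≤n = ≤-pointwise λ _ → natℚ-mono-≤ m≤n

fromℕ-suc-* : ∀ k x → fromℕ k * x + x ≃ fromℕ (suc k) * x
fromℕ-suc-* k x =
  ≡⇒≤ {fromℕ k * x + x} {fromℕ (suc k) * x} eq ,
  ≡⇒≤ {fromℕ (suc k) * x} {fromℕ k * x + x} (λ n → sym (eq n))
  where
  eq : ∀ n → natℚ k ℚ.* seq x n ℚ.+ seq x n ≡ natℚ (suc k) ℚ.* seq x n
  eq n = trans
    (solve 2 (λ k x → k :* x :+ x := (con 1ℚ :+ k) :* x) refl (natℚ k) (seq x n))
    (cong (ℚ._* seq x n) (sym (natℚ-+ 1 k)))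

-- Counting

isqrt : ∀ m → ∃ λ r → r ℕ.* r ℕ.≤ m × m ℕ.< suc r ℕ.* suc r
isqrt zero = 0 , ℕ.z≤n , ℕ.s≤s ℕ.z≤n
isqrt (suc m) with r , r²≤m , m<[1+r]² ← isqrt m | suc m ℕ.<? suc r ℕ.* suc r
... | yes 1+m<[1+r]² = r , ℕ.m≤n⇒m≤1+n r²≤m , 1+m<[1+r]²
... | no  1+m≮[1+r]² = suc r , ℕ.≮⇒≥ 1+m≮[1+r]² ,
  ℕ.≤-<-trans m<[1+r]² (ℕ.*-mono-< (ℕ.n<1+n (suc r)) (ℕ.n<1+n (suc r)))

-- Pigeonhole principle

length-filter-complement : ∀ {P : Pred A p} (P? : Decidable P) xs →
  length (filter P? xs) ℕ.+ length (filter (¬? ∘ P?) xs) ≡ length xs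
length-filter-complement P? [] = refl
length-filter-complement P? (x ∷ xs) with P? x
... | yes _ = cong suc (length-filter-complement P? xs)
... | no  _ = trans (ℕ.+-suc _ _) (cong suc (length-filter-complement P? xs))

lookup-injective : ∀ {xs : List A} → Unique xs → Injective _≡_ _≡_ (lookup xs)
lookup-injective (x∉xs ∷ _) {zero}  {zero}  _  = refl
lookup-injective (x∉xs ∷ _) {zero}  {suc j} eq = contradiction eq (All.lookup x∉xs (∈.∈-lookup j))
lookup-injective (x∉xs ∷ _) {suc i} {zero}  eq =
  contradiction (sym eq) (All.lookup x∉xs (∈.∈-lookup i))
lookup-injective (_ ∷ uniq) {suc i} {suc j} eq = cong suc (lookup-injective uniq eq)

-- Induction on the number of colours: either the class of the top colour has more than `s`
-- elements, or discarding it removes at most `s` and leaves more than `k * s` elements for `k`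
-- colours.
monochromaticSublist : ∀ (f : A → ℕ) k s xs → All (λ x → f x ℕ.< k) xs → Unique xs →
  k ℕ.* s ℕ.< length xs →
  ∃₂ λ c ys → All (λ y → f y ≡ c) ys × Unique ys × s ℕ.< length ys
monochromaticSublist f zero    s []       _         _    ()
monochromaticSublist f zero    s (x ∷ xs) (() ∷ _)
monochromaticSublist f (suc k) s xs       f<1+k     uniq 1+k*s<∣xs∣
  with s ℕ.<? length (filter (λ x → f x ℕ.≟ k) xs)
... | yes s<∣ys∣ = k , filter (λ x → f x ℕ.≟ k) xs , All.all-filter (λ x → f x ℕ.≟ k) xs ,
                   Unique.filter⁺ (λ x → f x ℕ.≟ k) uniq , s<∣ys∣
... | no  s≮∣ys∣ = monochromaticSublist f k s (filter f≢k? xs)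
  (All.zipWith (λ (f<1+k , f≢k) → ℕ.≤∧≢⇒< (ℕ.s≤s⁻¹ f<1+k) f≢k)
    (All.filter⁺ f≢k? f<1+k , All.all-filter f≢k? xs))
  (Unique.filter⁺ f≢k? uniq)
  (ℕ.+-cancelˡ-< s _ _ (ℕ.<-≤-trans 1+k*s<∣xs∣
    (ℕ.≤-trans (ℕ.≤-reflexive (sym (length-filter-complement (λ x → f x ℕ.≟ k) xs)))
               (ℕ.+-monoˡ-≤ _ (ℕ.≮⇒≥ s≮∣ys∣)))))
  where
  f≢k? = λ x → ¬? (f x ℕ.≟ k)

monochromatic : ∀ {k N} (f : Fin N → Fin k) s → k ℕ.* s ℕ.< N →
  ∃ λ (g : Fin (suc s) → Fin N) → Injective _≡_ _≡_ g × (∀ i j → f (g i) ≡ f (g j))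
monochromatic {k} {N} f s k*s<N
  with c , ys , mono , uniq , s<∣ys∣ ← monochromaticSublist (toℕ ∘ f) k s (allFin N)
         (All.universal (Fin.toℕ<n ∘ f) (allFin N)) (Unique.allFin⁺ N)
         (subst (k ℕ.* s ℕ.<_) (sym (List.length-tabulate {n = N} (λ i → i))) k*s<N) =
  g ,
  (λ eq → Fin.inject≤-injective s<∣ys∣ s<∣ys∣ _ _ (lookup-injective uniq eq)) ,
  λ i j → Fin.toℕ-injective (trans (colour i) (sym (colour j)))
  where
  g : Fin (suc s) → Fin N
  g i = lookup ys (inject≤ i s<∣ys∣)

  colour : ∀ i → toℕ (f (g i)) ≡ c
  colour i = All.lookup mono (∈.∈-lookup (inject≤ i s<∣ys∣))

module _ {S : Setoid a p} {m} (card : HasCardinality S m) where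

  open Setoid S using (Carrier; _≈_) renaming (sym to ≈-sym; trans to ≈-trans)
  open Bijection card using (to; strictlySurjective)

  index : Carrier → Fin m
  index x = proj₁ (strictlySurjective x)

  index-injective : ∀ {x y} → index x ≡ index y → x ≈ y
  index-injective {x} {y} eq = ≈-trans (≈-sym (proj₂ (strictlySurjective x)))
    (subst (λ i → to i ≈ y) (sym eq) (proj₂ (strictlySurjective y)))

-- `P` need not be decidable, so the boundary is found only under double negation. If there were
-- none, `P n` would make `n` one; hence `P` fails at `n` too, and the descent ends in a
-- contradiction with `P 0`.
¬¬-boundary : ∀ (P : Pred ℕ p) n → P 0 → ¬ P n →
              ¬ ¬ ∃ λ b → b ℕ.< n × P b × ¬ P (suc b)
¬¬-boundary P zero    P0 ¬Pn _ = ¬Pn P0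
¬¬-boundary P (suc n) P0 ¬P1+n k = ¬¬-boundary P n P0
  (λ Pn → k (n , ℕ.n<1+n n , Pn , ¬P1+n))
  (λ (b , b<n , Pb , ¬P1+b) → k (b , ℕ.m<n⇒m<1+n b<n , Pb , ¬P1+b))

-- As r ≥ 1, 2(2r + 1) ≤ 6r and thus N + 1 ≤ 2N ≤ 6rmB; squaring and r² ≤ m produce the constant 36.
count-bound : ∀ {N m B r} → 1 ℕ.≤ N → 1 ℕ.≤ m → r ℕ.* r ℕ.≤ m → m ℕ.< suc r ℕ.* suc r →
  N ℕ.≤ m ℕ.* B ℕ.* (r ℕ.+ suc r) →
  suc N ℕ.* suc N ℕ.≤ 36 ℕ.* (m ℕ.* (m ℕ.* m)) ℕ.* (B ℕ.* B)
count-bound {r = zero} _ 1≤m _ m<1 _ = contradiction 1≤m (ℕ.<⇒≱ m<1)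
count-bound {N} {m} {B} {r@(suc r′)} 1≤N 1≤m r²≤m _ N≤ = begin
  suc N ℕ.* suc N
    ≤⟨ ℕ.*-mono-≤ 1+N≤ 1+N≤ ⟩
  (m ℕ.* B ℕ.* (6 ℕ.* r)) ℕ.* (m ℕ.* B ℕ.* (6 ℕ.* r))
    ≡⟨ square m B r ⟩
  36 ℕ.* (r ℕ.* r ℕ.* (m ℕ.* m)) ℕ.* (B ℕ.* B)
    ≤⟨ ℕ.*-monoˡ-≤ (B ℕ.* B) (ℕ.*-monoʳ-≤ 36 (ℕ.*-monoˡ-≤ (m ℕ.* m) r²≤m)) ⟩
  36 ℕ.* (m ℕ.* (m ℕ.* m)) ℕ.* (B ℕ.* B) ∎
  where
  open ℕ.≤-Reasoning

  square : ∀ m B r → (m ℕ.* B ℕ.* (6 ℕ.* r)) ℕ.* (m ℕ.* B ℕ.* (6 ℕ.* r)) ≡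
                     36 ℕ.* (r ℕ.* r ℕ.* (m ℕ.* m)) ℕ.* (B ℕ.* B)
  square = ℕ-Solver.solve-∀

  -- For r = `suc s`, the last summand `s + s` is the slack 2r - 2 between 4r + 2 and 6r.
  4r+2≤6r : ∀ s → suc s ℕ.+ suc (suc s) ℕ.+ (suc s ℕ.+ suc (suc s)) ℕ.+ (s ℕ.+ s) ≡
                        6 ℕ.* suc s
  4r+2≤6r = ℕ-Solver.solve-∀

  1+N≤ : suc N ℕ.≤ m ℕ.* B ℕ.* (6 ℕ.* r)
  1+N≤ = begin
    suc N
      ≤⟨ ℕ.+-monoˡ-≤ N 1≤N ⟩
    N ℕ.+ N
      ≤⟨ ℕ.+-mono-≤ N≤ N≤ ⟩
    m ℕ.* B ℕ.* (r ℕ.+ suc r) ℕ.+ m ℕ.* B ℕ.* (r ℕ.+ suc r)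
      ≡⟨ ℕ.*-distribˡ-+ (m ℕ.* B) (r ℕ.+ suc r) (r ℕ.+ suc r) ⟨
    m ℕ.* B ℕ.* (r ℕ.+ suc r ℕ.+ (r ℕ.+ suc r))
      ≤⟨ ℕ.*-monoʳ-≤ (m ℕ.* B) (ℕ.m+n≤o⇒m≤o _ (ℕ.≤-reflexive (4r+2≤6r r′))) ⟩
    m ℕ.* B ℕ.* (6 ℕ.* r) ∎

-- Comparing `m`, `n`, `D` and `δ` without division

module _ {D δ ρ : ℝ} (0≤δ : 0ℝ ≤ δ) (δ≰0 : ¬ (δ ≤ 0ℝ)) (δ≤D : δ ≤ D) (ρ*δ≃D : ρ * δ ≃ D) where

  private
    0≤D : 0ℝ ≤ D
    0≤D = ≤-trans 0≤δ δ≤D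

    0≤D*D : 0ℝ ≤ D * D
    0≤D*D = 0≤x*y D D 0≤D 0≤D

    0≤δ*δ : 0ℝ ≤ δ * δ
    0≤δ*δ = 0≤x*y δ δ 0≤δ 0≤δ

    0≤fromℕ : ∀ k → 0ℝ ≤ fromℕ k
    0≤fromℕ k = fromℕ-mono-≤ {0} {k} ℕ.z≤n

  -- This is 64m³ρ² ≤ n² multiplied by δ². Cubing m ≤ t/4 gives 64m³ ≤ t³ = (n/ρ)², and D = ρδ turns
  -- (n/ρ)²D² into n²δ².
  fromℕ[64m³]*D²≤fromℕ[n²]*δ² : ∀ {n m n/ρ t} → n/ρ * ρ ≃ fromℕ n → IsPowerTwoThirds n/ρ t →
    fromℕ m ≤ fromℚ (+ 1 ℚ./ 4) * t →
    fromℕ (64 ℕ.* (m ℕ.* (m ℕ.* m))) * (D * D) ≤ fromℕ (n ℕ.* n) * (δ * δ)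
  fromℕ[64m³]*D²≤fromℕ[n²]*δ² {n} {m} {q} {t} q*ρ≃n (0≤q , 0≤t , t³≃q²) M≤T = begin
    fromℕ (64 ℕ.* (m ℕ.* (m ℕ.* m))) * (D * D)
      ≤⟨ ≡⇒≤ {fromℕ (64 ℕ.* (m ℕ.* (m ℕ.* m))) * (D * D)} {fromℕ 64 * (M * (M * M)) * (D * D)}
           (λ k → cong (ℚ._* (seq D k ℚ.* seq D k))
             (trans (natℚ-* 64 (m ℕ.* (m ℕ.* m))) (cong (natℚ 64 ℚ.*_)
               (trans (natℚ-* m (m ℕ.* m)) (cong (natℚ m ℚ.*_) (natℚ-* m m)))))) ⟩
    fromℕ 64 * (M * (M * M)) * (D * D)
      ≤⟨ *-monoʳ-≤-nonNeg (fromℕ 64 * (M * (M * M))) (fromℕ 64 * (T * (T * T))) (D * D) 0≤D*D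
           (*-monoˡ-≤-nonNeg (fromℕ 64) (M * (M * M)) (T * (T * T)) (0≤fromℕ 64)
             (*-mono-≤ M T (M * M) (T * T) 0≤T (0≤x*y M M 0≤M 0≤M) M≤T
               (*-mono-≤ M T M T 0≤T 0≤M M≤T M≤T))) ⟩
    fromℕ 64 * (T * (T * T)) * (D * D)
      ≤⟨ ≡⇒≤ {fromℕ 64 * (T * (T * T)) * (D * D)} {t ^ 3 * (D * D)}
           (λ k → cong (ℚ._* (seq D k ℚ.* seq D k)) (cube (seq t k))) ⟩
    t ^ 3 * (D * D)
      ≤⟨ *-monoʳ-≤-nonNeg (t ^ 3) (q ^ 2) (D * D) 0≤D*D (proj₁ t³≃q²) ⟩
    q ^ 2 * (D * D)
      ≤⟨ *-monoˡ-≤-nonNeg (q ^ 2) (D * D) (ρ * δ * (ρ * δ)) 0≤q²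
           (*-mono-≤ D (ρ * δ) D (ρ * δ) 0≤ρδ 0≤D (proj₂ ρ*δ≃D) (proj₂ ρ*δ≃D)) ⟩
    q ^ 2 * (ρ * δ * (ρ * δ))
      ≤⟨ ≡⇒≤ {q ^ 2 * (ρ * δ * (ρ * δ))} {q * ρ * (q * ρ) * (δ * δ)}
           (λ k → rearrange (seq q k) (seq ρ k) (seq δ k)) ⟩
    q * ρ * (q * ρ) * (δ * δ)
      ≤⟨ *-monoʳ-≤-nonNeg (q * ρ * (q * ρ)) (fromℕ n * fromℕ n) (δ * δ) 0≤δ*δ
           (*-mono-≤ (q * ρ) (fromℕ n) (q * ρ) (fromℕ n) (0≤fromℕ n)
             (≤-trans (0≤fromℕ n) (proj₂ q*ρ≃n)) (proj₁ q*ρ≃n) (proj₁ q*ρ≃n)) ⟩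
    fromℕ n * fromℕ n * (δ * δ)
      ≤⟨ ≡⇒≤ {fromℕ n * fromℕ n * (δ * δ)} {fromℕ (n ℕ.* n) * (δ * δ)}
           (λ k → cong (ℚ._* (seq δ k ℚ.* seq δ k)) (sym (natℚ-* n n))) ⟩
    fromℕ (n ℕ.* n) * (δ * δ) ∎
    where
    open ≤-Reasoning
    M = fromℕ m
    T = fromℚ (+ 1 ℚ./ 4) * t
    0≤M = 0≤fromℕ m
    0≤T = ≤-trans 0≤M M≤T
    0≤ρδ = ≤-trans 0≤D (proj₂ ρ*δ≃D)
    0≤q² : 0ℝ ≤ q ^ 2
    0≤q² = ≤-trans (0≤x*y q q 0≤q 0≤q)
      (≡⇒≤ {q * q} {q ^ 2} λ k → cong (seq q k ℚ.*_) (sym (ℚ.*-identityʳ (seq q k))))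

    cube : ∀ t → natℚ 64 ℚ.* ((+ 1 ℚ./ 4) ℚ.* t ℚ.* ((+ 1 ℚ./ 4) ℚ.* t ℚ.* ((+ 1 ℚ./ 4) ℚ.* t)))
               ≡ t ℚ.* (t ℚ.* (t ℚ.* 1ℚ))
    cube = solve 1 (λ t → con (natℚ 64) :* (con (+ 1 ℚ./ 4) :* t :*
        (con (+ 1 ℚ./ 4) :* t :* (con (+ 1 ℚ./ 4) :* t))) := t :* (t :* (t :* con 1ℚ))) refl

    rearrange : ∀ q ρ δ → q ℚ.* (q ℚ.* 1ℚ) ℚ.* (ρ ℚ.* δ ℚ.* (ρ ℚ.* δ))
                        ≡ q ℚ.* ρ ℚ.* (q ℚ.* ρ) ℚ.* (δ ℚ.* δ)
    rearrange = solve 3 (λ q ρ δ → q :* (q :* con 1ℚ) :* (ρ :* δ :* (ρ :* δ)) :=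
        q :* ρ :* (q :* ρ) :* (δ :* δ)) refl

  -- With `k` = 36m³, Bδ ≤ D would give (k + 1)D² ≤ 64m³D² ≤ n²δ² ≤ kB²δ² ≤ kD², hence D ≤ 0,
  -- against δ ≤ D and `δ≰0`. The gap between 36 and 64 makes up for `lower` being non-strict.
  fromℕ-*-≰ : ∀ {n m B} → 1 ℕ.≤ m →
    fromℕ (64 ℕ.* (m ℕ.* (m ℕ.* m))) * (D * D) ≤ fromℕ (n ℕ.* n) * (δ * δ) →
    n ℕ.* n ℕ.≤ 36 ℕ.* (m ℕ.* (m ℕ.* m)) ℕ.* (B ℕ.* B) → ¬ (fromℕ B * δ ≤ D)
  fromℕ-*-≰ {n} {m} {B} 1≤m lower n²≤36m³B² Bδ≤D = δ≰0 (≤-trans δ≤D (x*x≤0⇒x≤0 {D}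
    (+-cancelˡ-≤ {D * D} {0ℝ} (fromℕ k * (D * D)) (begin
      fromℕ k * (D * D) + D * D
        ≤⟨ proj₁ (fromℕ-suc-* k (D * D)) ⟩
      fromℕ (suc k) * (D * D)
        ≤⟨ *-monoʳ-≤-nonNeg (fromℕ (suc k)) (fromℕ (64 ℕ.* (m ℕ.* (m ℕ.* m)))) (D * D) 0≤D*D
             (fromℕ-mono-≤ k<64m³) ⟩
      fromℕ (64 ℕ.* (m ℕ.* (m ℕ.* m))) * (D * D)
        ≤⟨ lower ⟩
      fromℕ (n ℕ.* n) * (δ * δ)
        ≤⟨ *-monoʳ-≤-nonNeg (fromℕ (n ℕ.* n)) (fromℕ (k ℕ.* (B ℕ.* B))) (δ * δ) 0≤δ*δ
             (fromℕ-mono-≤ n²≤36m³B²) ⟩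
      fromℕ (k ℕ.* (B ℕ.* B)) * (δ * δ)
        ≤⟨ ≡⇒≤ {fromℕ (k ℕ.* (B ℕ.* B)) * (δ * δ)} {fromℕ k * (fromℕ B * δ * (fromℕ B * δ))}
             (λ i → trans
               (cong (ℚ._* (seq δ i ℚ.* seq δ i))
                 (trans (natℚ-* k (B ℕ.* B)) (cong (natℚ k ℚ.*_) (natℚ-* B B))))
               (rearrange (natℚ k) (natℚ B) (seq δ i))) ⟩
      fromℕ k * (fromℕ B * δ * (fromℕ B * δ))
        ≤⟨ *-monoˡ-≤-nonNeg (fromℕ k) (fromℕ B * δ * (fromℕ B * δ)) (D * D) (0≤fromℕ k)
             (*-mono-≤ (fromℕ B * δ) D (fromℕ B * δ) D 0≤D
               (0≤x*y (fromℕ B) δ (0≤fromℕ B) 0≤δ) Bδ≤D Bδ≤D) ⟩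
      fromℕ k * (D * D)
        ≤⟨ ≡⇒≤ {fromℕ k * (D * D)} {fromℕ k * (D * D) + 0ℝ}
             (λ i → sym (ℚ.+-identityʳ (natℚ k ℚ.* (seq D i ℚ.* seq D i)))) ⟩
      fromℕ k * (D * D) + 0ℝ ∎))))
    where
    open ≤-Reasoning
    k = 36 ℕ.* (m ℕ.* (m ℕ.* m))
    k<64m³ : k ℕ.< 64 ℕ.* (m ℕ.* (m ℕ.* m))
    k<64m³ = ℕ.*-monoˡ-< (m ℕ.* (m ℕ.* m)) {{ℕ.>-nonZero (ℕ.*-mono-≤ 1≤m (ℕ.*-mono-≤ 1≤m 1≤m))}}
      (ℕ.m<m+n 36 {28} (ℕ.s≤s ℕ.z≤n))
    rearrange : ∀ k B δ → k ℚ.* (B ℚ.* B) ℚ.* (δ ℚ.* δ) ≡ k ℚ.* (B ℚ.* δ ℚ.* (B ℚ.* δ))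
    rearrange = solve 3 (λ k B δ → k :* (B :* B) :* (δ :* δ) := k :* (B :* δ :* (B :* δ))) refl

-- Metric spaces

-- F is abstract: for line d, conversion checking would descend into the Cauchy
-- sequences of the distances.
≈⇒≐ : ∀ {X : Set a} (F : X → X → Pred X a) {u v u′ v′} (p : u ≢ v) (q : u′ ≢ v′) →
  Setoid._≈_ (On.setoid {B = ∃₂ λ (u v : X) → u ≢ v} (≐-setoid X a) λ (u , v , _) → F u v)
    (u , v , p) (u′ , v′ , q) →
  F u v ≐ F u′ v′
≈⇒≐ F p q F≈F′ = F≈F′

-- k is ⌊z/δ⌋ − 1.
Bucket : ℝ → ℕ → ℝ → Set
Bucket δ B z = ∃ λ k → k ℕ.< B × fromℕ (suc k) * δ ≤ z × ¬ (fromℕ (suc (suc k)) * δ ≤ z)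

-- The condition (k + 1)δ ≤ z holds at k = 0 and fails at k = B; a bucket is a boundary in between.
¬¬-bucket : ∀ δ B z → δ ≤ z → ¬ (fromℕ (suc B) * δ ≤ z) → ¬ ¬ Bucket δ B z
¬¬-bucket δ B z δ≤z = ¬¬-boundary (λ k → fromℕ (suc k) * δ ≤ z) B (≤-trans 1*δ≤δ δ≤z)
  where
  natℚ-1 : natℚ (suc 0) ≡ 1ℚ
  natℚ-1 = refl

  1*δ≤δ : fromℕ (suc 0) * δ ≤ δ
  1*δ≤δ = ≡⇒≤ {fromℕ (suc 0) * δ} {δ}
    λ k → trans (cong (ℚ._* seq δ k) natℚ-1) (ℚ.*-identityˡ (seq δ k))

module _ {X : Set a} {d : X → X → ℝ} (isMetric : IsMetric _≡_ d) where

  open Metric.IsGeneralMetric isMetric using (nonNegative; 0⇒≈; triangle)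

  -- Stars around a centre

  d≤0⇒≡ : ∀ {x y} → d x y ≤ 0ℝ → x ≡ y
  d≤0⇒≡ d≤0 = 0⇒≈ (d≤0 , nonNegative)

  -- The centre lies between any two different members; the reverse inequality is the triangle
  -- inequality.
  IsStar : ∀ {I : Set} → X → (I → X) → Set _
  IsStar x p = ∀ i j → p i ≢ p j → d (p i) x + d x (p j) ≤ d (p i) (p j)

  module _ {I : Set} {x : X} {p : I → X} (x≢p : ∀ i → x ≢ p i) (star : IsStar x p) where

    -- Writing ij for a distance, the star inequalities bound ix + xj + jx + xk by ij + jk = ik,
    -- which is at most ix + xk. So jx + xj ≤ 0, and the middle point would be the centre.
    star⇒¬collinear : ∀ i j k → ¬ [_,_,_] d (p i) (p j) (p k)
    star⇒¬collinear i j k ((i≢j , j≢k , _) , ij+jk≃ik) = x≢p j (d≤0⇒≡ (begin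
      d x (p j)
        ≤⟨ ≡⇒≤ {d x (p j)} {0ℝ + d x (p j)} (λ n → sym (ℚ.+-identityˡ (seq (d x (p j)) n))) ⟩
      0ℝ + d x (p j)
        ≤⟨ +-mono-≤ {0ℝ} {d (p j) x} {d x (p j)} {d x (p j)} nonNegative ≤-refl ⟩
      d (p j) x + d x (p j)
        ≤⟨ +-cancelˡ-≤ {d (p j) x + d x (p j)} {0ℝ} (d (p i) x + d x (p k)) there-and-back ⟩
      0ℝ ∎))
      where
      open ≤-Reasoning
      there-and-back : d (p i) x + d x (p k) + (d (p j) x + d x (p j)) ≤
                       d (p i) x + d x (p k) + 0ℝ
      there-and-back = begin
        d (p i) x + d x (p k) + (d (p j) x + d x (p j))
          ≤⟨ ≡⇒≤ {d (p i) x + d x (p k) + (d (p j) x + d x (p j))}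
                 {(d (p i) x + d x (p j)) + (d (p j) x + d x (p k))}
               (λ n → rearrange (seq (d (p i) x) n) (seq (d x (p k)) n)
                                (seq (d (p j) x) n) (seq (d x (p j)) n)) ⟩
        (d (p i) x + d x (p j)) + (d (p j) x + d x (p k))
          ≤⟨ +-mono-≤ {d (p i) x + d x (p j)} {d (p i) (p j)}
                      {d (p j) x + d x (p k)} {d (p j) (p k)}
               (star i j i≢j) (star j k j≢k) ⟩
        d (p i) (p j) + d (p j) (p k)
          ≤⟨ proj₁ ij+jk≃ik ⟩
        d (p i) (p k)
          ≤⟨ triangle (p i) x (p k) ⟩
        d (p i) x + d x (p k)
          ≤⟨ ≡⇒≤ {d (p i) x + d x (p k)} {d (p i) x + d x (p k) + 0ℝ}
               (λ n → sym (ℚ.+-identityʳ (seq (d (p i) x) n ℚ.+ seq (d x (p k)) n))) ⟩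
        d (p i) x + d x (p k) + 0ℝ ∎
        where
        rearrange : ∀ a b c e → a ℚ.+ b ℚ.+ (c ℚ.+ e) ≡ (a ℚ.+ e) ℚ.+ (c ℚ.+ b)
        rearrange = solve 4 (λ a b c e → a :+ b :+ (c :+ e) := (a :+ e) :+ (c :+ b)) refl

    -- Every betweenness alternative is a collinear triple of the star. A line through two star
    -- points therefore determines that pair.
    star-line : ∀ i j k → line d (p i) (p j) (p k) → p k ≡ p i ⊎ p k ≡ p j
    star-line i j k (inj₁ kij)                      = contradiction kij (star⇒¬collinear k i j)
    star-line i j k (inj₂ (inj₁ k≡i))               = inj₁ k≡i
    star-line i j k (inj₂ (inj₂ (inj₁ ikj)))        = contradiction ikj (star⇒¬collinear i k j)
    star-line i j k (inj₂ (inj₂ (inj₂ (inj₁ k≡j)))) = inj₂ k≡j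
    star-line i j k (inj₂ (inj₂ (inj₂ (inj₂ ijk)))) = contradiction ijk (star⇒¬collinear i j k)

  -- Counting the lines of a star

  module _ {m : ℕ} (card : HasCardinality (lines d) m) where

    lineIndex : ∀ {u v} → u ≢ v → Fin m
    lineIndex {u} {v} u≢v = index {S = lines d} card (u , v , u≢v)

    lineIndex-injective : ∀ {u v u′ v′} (p : u ≢ v) (q : u′ ≢ v′) →
      lineIndex p ≡ lineIndex q → line d u v ≐ line d u′ v′
    lineIndex-injective {u} {v} {u′} {v′} p q eq = ≈⇒≐ (line d) p q
      (index-injective {S = lines d} card {u , v , p} {u′ , v′ , q} eq)

    -- Pairs with one point in each half form a plain product; using all pairs
    -- would only improve the constant.
    star-bound : ∀ h {x} {p : Fin (h ℕ.+ h) → X} → (∀ i → x ≢ p i) → IsStar x p →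
                 Injective _≡_ _≡_ p → h ℕ.* h ℕ.≤ m
    star-bound h {x} {p} x≢p star p-injective = Fin.injective⇒≤ productIndex-injective
      where
      left right : Fin h → Fin (h ℕ.+ h)
      left i = i ↑ˡ h
      right j = h ↑ʳ j

      left≢right : ∀ i j → p (left i) ≢ p (right j)
      left≢right i j eq with trans (sym (Fin.splitAt-↑ˡ h i h))
        (trans (cong (splitAt h) (p-injective eq)) (Fin.splitAt-↑ʳ h h j))
      ... | ()

      pairIndex : Fin h × Fin h → Fin m
      pairIndex (i , j) = lineIndex (left≢right i j)

      pairIndex-injective : ∀ k l → pairIndex k ≡ pairIndex l → k ≡ l
      pairIndex-injective (i , j) (i′ , j′) eq = resolve
        (star-line x≢p star (left i′) (right j′) (left i)
          (ij⊆i′j′ {p (left i)} (inj₂ (inj₁ refl))))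
        (star-line x≢p star (left i′) (right j′) (right j)
          (ij⊆i′j′ {p (right j)} (inj₂ (inj₂ (inj₂ (inj₁ refl))))))
        where
        ij⊆i′j′ : line d (p (left i)) (p (right j)) ⊆ line d (p (left i′)) (p (right j′))
        ij⊆i′j′ = proj₁ (lineIndex-injective (left≢right i j) (left≢right i′ j′) eq)

        -- Both generating points lie on the line of the other pair, hence belong to that pair;
        -- points of different halves never coincide, so the matching respects the halves.
        resolve : p (left i) ≡ p (left i′) ⊎ p (left i) ≡ p (right j′) →
                  p (right j) ≡ p (left i′) ⊎ p (right j) ≡ p (right j′) →
                  (i , j) ≡ (i′ , j′)
        resolve (inj₂ i≡j′) _           = contradiction i≡j′ (left≢right i j′)
        resolve (inj₁ _)    (inj₁ j≡i′) = contradiction (sym j≡i′) (left≢right i′ j)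
        resolve (inj₁ i≡i′) (inj₂ j≡j′) = cong₂ _,_
          (Fin.↑ˡ-injective h i i′ (p-injective i≡i′)) (Fin.↑ʳ-injective h j j′ (p-injective j≡j′))

      productIndex : Fin (h ℕ.* h) → Fin m
      productIndex k = pairIndex (remQuot h k)

      productIndex-injective : Injective _≡_ _≡_ productIndex
      productIndex-injective {k} {l} eq = trans (sym (Fin.combine-remQuot {h} h k))
        (trans (cong (uncurry combine) (pairIndex-injective (remQuot h k) (remQuot h l) eq))
          (Fin.combine-remQuot {h} h l))

  -- Colouring by line and bucket

  module _ {δ : ℝ} (δ≤d : ∀ {x y} → x ≢ y → δ ≤ d x y) where

    -- Passing from `y` on to `z` adds at least `δ`, so the farther point moves up by at least one
    -- bucket.
    [xyz]⇒bucket< : ∀ {x y z} k → fromℕ k * δ ≤ d x y → [_,_,_] d x y z →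
                    fromℕ (suc k) * δ ≤ d x z
    [xyz]⇒bucket< {x} {y} {z} k kδ≤xy ((_ , y≢z , _) , xy+yz≃xz) = begin
      fromℕ (suc k) * δ      ≤⟨ proj₂ (fromℕ-suc-* k δ) ⟩
      fromℕ k * δ + δ        ≤⟨ +-mono-≤ {fromℕ k * δ} {d x y} {δ} {d y z} kδ≤xy (δ≤d y≢z) ⟩
      d x y + d y z          ≤⟨ proj₁ xy+yz≃xz ⟩
      d x z                  ∎
      where open ≤-Reasoning

    -- The two equalities contradict distinctness, and a point beyond the other as seen from `x`
    -- would lie in a higher bucket; only `x` in the middle remains.
    sameBucket⇒between : ∀ {x y z k l} → k ≡ l → y ≢ z → x ≢ y →
      fromℕ k * δ ≤ d x y → ¬ (fromℕ (suc k) * δ ≤ d x y) →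
      fromℕ l * δ ≤ d x z → ¬ (fromℕ (suc l) * δ ≤ d x z) →
      line d x z y → [_,_,_] d y x z
    sameBucket⇒between {k = k} refl y≢z x≢y kδ≤xy xy<k+1δ kδ≤xz xz<k+1δ = λ where
      (inj₁ yxz)                      → yxz
      (inj₂ (inj₁ y≡x))               → contradiction (sym y≡x) x≢y
      (inj₂ (inj₂ (inj₁ xyz)))        → contradiction ([xyz]⇒bucket< k kδ≤xy xyz) xz<k+1δ
      (inj₂ (inj₂ (inj₂ (inj₁ y≡z)))) → contradiction y≡z y≢z
      (inj₂ (inj₂ (inj₂ (inj₂ xzy)))) → contradiction ([xyz]⇒bucket< k kδ≤xz xzy) xy<k+1δ

    -- There are `m * B` colours. Were the bound to fail, 2(h + 1) points would share a colour and
    -- form a star, whose two halves yield (h + 1)² ≤ m.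
    pigeonhole-bound : ∀ {m N B x} {y : Fin N → X} → HasCardinality (lines d) m →
      (∀ i → x ≢ y i) → Injective _≡_ _≡_ y → (∀ i → Bucket δ B (d x (y i))) →
      ∀ h → m ℕ.< suc h ℕ.* suc h → N ℕ.≤ m ℕ.* B ℕ.* (h ℕ.+ suc h)
    pigeonhole-bound {m} {N} {B} {x} {y} card x≢y y-injective c h m<[1+h]² = ℕ.≮⇒≥ λ many →
      -- The class has one point more than `h + suc h`, and `suc (h + suc h)` computes to
      -- `suc h + suc h`, two halves of equal size.
      let g , g-injective , sameColour = monochromatic colour (h ℕ.+ suc h) many
      in ℕ.<⇒≱ m<[1+h]² (star-bound card (suc h) {x} {λ i → y (g i)} (λ i → x≢y (g i))
           (λ i j yi≢yj → proj₁ (proj₂ (between (g i) (g j) yi≢yj (sameColour i j))))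
           (λ eq → g-injective (y-injective eq)))
      where
      bucket : Fin N → Fin B
      bucket i = fromℕ< (proj₁ (proj₂ (c i)))

      lineThrough : Fin N → Fin m
      lineThrough i = lineIndex card (x≢y i)

      colour : Fin N → Fin (m ℕ.* B)
      colour i = combine (lineThrough i) (bucket i)

      between : ∀ i j → y i ≢ y j → colour i ≡ colour j → [_,_,_] d (y i) x (y j)
      between i j yi≢yj eq = fromSameBucket (c i) (c j)
        (Fin.combine-injectiveʳ (lineThrough i) (bucket i) (lineThrough j) (bucket j) eq)
        where
        -- `y i` is an endpoint of its own line, which coincides with the line of `y j`.
        yi∈ : line d x (y j) (y i)
        yi∈ = proj₁ (lineIndex-injective card (x≢y i) (x≢y j)
          (Fin.combine-injectiveˡ (lineThrough i) (bucket i) (lineThrough j) (bucket j) eq))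
          {y i} (inj₂ (inj₂ (inj₂ (inj₁ refl))))

        fromSameBucket : ∀ (ci : Bucket δ B (d x (y i))) (cj : Bucket δ B (d x (y j))) →
          fromℕ< (proj₁ (proj₂ ci)) ≡ fromℕ< (proj₁ (proj₂ cj)) → [_,_,_] d (y i) x (y j)
        fromSameBucket (k , k<B , i≥ , i≱) (l , l<B , j≥ , j≱) k≡l =
          sameBucket⇒between (cong suc (Fin.fromℕ<-injective k l k<B l<B k≡l))
            yi≢yj (x≢y i) i≥ i≱ j≥ j≱ yi∈

-- The lower bound, by counting around one point

theorem1 :
    ∀ {a} (n : ℕ) → 2 ℕ.≤ n →
    (X : Set a) (d : X → X → ℝ) → IsMetric _≡_ d → Fin n ↔ X →
    (ρ : ℝ) → IsDistanceRatio d ρ →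
    (n/ρ : ℝ) → IsQuotient (fromℕ n) ρ n/ρ →
    (t : ℝ) → IsPowerTwoThirds n/ρ t →
    (m : ℕ) → HasCardinality (lines d) m →
    fromℚ (+ 1 ℚ./ 4) * t ≤ fromℕ m
-- From here on `n` counts the points other than `x₀`; the space has `suc n` points.
theorem1 (suc n@(suc _)) (ℕ.s≤s 1≤n) X d isMetric Fin↔X
  ρ (D , δ , (_ , d≤D) , ((u , v , uv≃δ) , δ≄0 , δ-smallest) , (_ , ρ*δ≃D))
  n/ρ (_ , n/ρ*ρ≃n) t t≡[n/ρ]^⅔ m card =
  -- By stability it is enough to refute the negated goal, which supplies the non-strict m ≤ t/4.
  ≤-stable λ T≰m → ¬manyLines (≰⇒≥ T≰m)
  where
  open Inverse Fin↔X using (to)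
  open Metric.IsGeneralMetric isMetric using (nonNegative)

  to-injective : Injective _≡_ _≡_ to
  to-injective = Injection.injective (↔⇒↣ Fin↔X)

  x₀ : X
  x₀ = to zero

  ys : Fin n → X
  ys i = to (suc i)

  x₀≢ys : ∀ i → x₀ ≢ ys i
  x₀≢ys i eq with () ← to-injective eq

  ys-injective : Injective _≡_ _≡_ ys
  ys-injective eq = Fin.suc-injective (to-injective eq)

  0≤δ : 0ℝ ≤ δ
  0≤δ = ≤-trans nonNegative (proj₁ uv≃δ)

  δ≰0 : ¬ (δ ≤ 0ℝ)
  δ≰0 δ≤0 = δ≄0 (δ≤0 , 0≤δ)

  δ≤D : δ ≤ D
  δ≤D = ≤-trans (proj₂ uv≃δ) (d≤D u v)

  δ≤d : ∀ {x y} → x ≢ y → δ ≤ d x y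
  δ≤d {x} {y} x≢y = δ-smallest x y λ d≃0 → x≢y (d≤0⇒≡ isMetric (proj₁ d≃0))

  1≤m : 1 ℕ.≤ m
  1≤m = ℕ.≤-trans (ℕ.s≤s ℕ.z≤n) (Fin.toℕ<n (lineIndex isMetric card (x₀≢ys zero)))

  r : ℕ
  r = proj₁ (isqrt m)

  r²≤m : r ℕ.* r ℕ.≤ m
  r²≤m = proj₁ (proj₂ (isqrt m))

  m<[1+r]² : m ℕ.< suc r ℕ.* suc r
  m<[1+r]² = proj₂ (proj₂ (isqrt m))

  -- Distances from `x₀` to the other points are at least `δ` and below (B + 1)δ, so ⌊z/δ⌋ ranges
  -- over 1 to B only, which makes `B` buckets.
  buckets : ∀ B → ¬ (fromℕ (suc B) * δ ≤ D) → ∀ i → ¬ ¬ Bucket δ B (d x₀ (ys i))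
  buckets B D≱ i = ¬¬-bucket δ B (d x₀ (ys i)) (δ≤d (x₀≢ys i))
    λ xy≥ → D≱ (≤-trans xy≥ (d≤D x₀ (ys i)))

  counting : ∀ B → (∀ i → Bucket δ B (d x₀ (ys i))) →
             suc n ℕ.* suc n ℕ.≤ 36 ℕ.* (m ℕ.* (m ℕ.* m)) ℕ.* (B ℕ.* B)
  counting B bs = count-bound 1≤n 1≤m r²≤m m<[1+r]²
    (pigeonhole-bound {d = d} isMetric {δ} δ≤d {m} {n} {B} {x₀} {ys}
      card x₀≢ys ys-injective bs r m<[1+r]²)

  module _ (m≤T : fromℕ m ≤ fromℚ (+ 1 ℚ./ 4) * t) where

    -- Applied twice: with `B` the number of points, where the counting inequality is trivial, and
    -- with `B` = ⌊D/δ⌋, where it comes from the colouring.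
    tooFew : ∀ B → suc n ℕ.* suc n ℕ.≤ 36 ℕ.* (m ℕ.* (m ℕ.* m)) ℕ.* (B ℕ.* B) →
             ¬ (fromℕ B * δ ≤ D)
    tooFew B = fromℕ-*-≰ {D} {δ} {ρ} 0≤δ δ≰0 δ≤D ρ*δ≃D {suc n} {m} {B} 1≤m
      (fromℕ[64m³]*D²≤fromℕ[n²]*δ² {D} {δ} {ρ} 0≤δ δ≰0 δ≤D ρ*δ≃D
        {suc n} {m} {n/ρ} {t} n/ρ*ρ≃n t≡[n/ρ]^⅔ m≤T)

    -- A bound on D/δ that comes from the assumption, without the Archimedean property.
    D≱nδ : ¬ (fromℕ (suc n) * δ ≤ D)
    D≱nδ = tooFew (suc n) (ℕ.m≤n*m (suc n ℕ.* suc n) (36 ℕ.* (m ℕ.* (m ℕ.* m)))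
      {{ℕ.>-nonZero (ℕ.*-mono-≤ (ℕ.s≤s (ℕ.z≤n {35})) (ℕ.*-mono-≤ 1≤m (ℕ.*-mono-≤ 1≤m 1≤m)))}})

    ¬manyLines : ⊥
    -- `D` itself is put in a bucket, so that `suc b` is ⌊D/δ⌋.
    ¬manyLines = ¬¬-bucket δ n D δ≤D D≱nδ λ (b , _ , D≥ , D≱) →
      -- Double negation commutes with finite products, so the buckets of all `n` points may be
      -- chosen at once.
      Fin.sequence (RawMonad.rawApplicative ¬¬-Monad) {P = λ i → Bucket δ (suc b) (d x₀ (ys i))}
        (buckets (suc b) D≱)
        λ bs → tooFew (suc b) (counting (suc b) bs) D≥
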